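{- Up to isomorphism, there are exactly 3 minimal obstructions to $C_5$-coloring among $S_{2,2,1}$-free graphs, and exactly 5 minimal obstructions to $C_5$-coloring among $S_{3,1,1}$-free graphs.
   Context: All graphs are finite and simple. For graphs $G$ and $H$, an $H$-coloring of $G$ is a map $c: V(G)\to V(H)$ such that $c(u)c(v)\in E(H)$ for every edge $uv\in E(G)$. A graph $G$ is a minimal obstruction to $H$-coloring if $G$ has no $H$-coloring but every proper induced subgraph of $G$ has an $H$-coloring. $C_5$ is the cycle on five vertices. For integers $a,b,c\ge 1$, $S_{a,b,c}$ is the graph obtained from the paths $P_{a+1},P_{b+1},P_{c+1}$ (where $P_t$ is the path on $t$ vertices) by identifying one endvertex of each of them into a single vertex. A graph is $F$-free if it does not contain $F$ as an induced subgraph. -}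

module Defs where

open import Data.Nat using (ℕ; zero; suc; _+_; _≡ᵇ_; _%_)
open import Data.Fin using (Fin; toℕ)
open import Data.Fin.Patterns
open import Data.Bool using (Bool; true; false; _∧_; _∨_; not)
open import Data.Bool.Properties using (∨-comm)
open import Data.Product using (Σ; ∃; _×_; _,_)
open import Data.Sum using (_⊎_)
open import Relation.Binary.PropositionalEquality using (_≡_; refl; cong)
open import Relation.Nullary using (¬_)
open import Function.Definitions using (Injective)

record Graph : Set where
  field
    n     : ℕ
    adj   : Fin n → Fin n → Bool
    sym   : ∀ u v → adj u v ≡ adj v u
    loopless : ∀ v → adj v v ≡ false
open Graph public

HColoring : Graph → Graph → Set
HColoring G H = Σ (Fin (n G) → Fin (n H)) λ c →
  ∀ u v → adj G u v ≡ true → adj H (c u) (c v) ≡ true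

HColorable : Graph → Graph → Set
HColorable G H = HColoring G H

-- Subsets of the vertex set, given by a characteristic function.
-- The subgraph of G induced by S has an H-coloring:
-- a map on the vertices of S preserving adjacency among vertices of S
-- (values outside S are irrelevant).
InducedHColorable : (G : Graph) → (Fin (n G) → Bool) → Graph → Set
InducedHColorable G S H = Σ (Fin (n G) → Fin (n H)) λ c →
  ∀ u v → S u ≡ true → S v ≡ true → adj G u v ≡ true →
    adj H (c u) (c v) ≡ true

MinimalObstruction : Graph → Graph → Set
MinimalObstruction G H =
  ¬ HColorable G H ×
  (∀ (S : Fin (n G) → Bool) → (∃ λ v → S v ≡ false) → InducedHColorable G S H)

ContainsInduced : Graph → Graph → Set
ContainsInduced G F = Σ (Fin (n F) → Fin (n G)) λ f →
  Injective _≡_ _≡_ f × (∀ u v → adj G (f u) (f v) ≡ adj F u v)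

Free : Graph → Graph → Set
Free F G = ¬ ContainsInduced G F

record Iso (G H : Graph) : Set where
  field
    to      : Fin (n G) → Fin (n H)
    from    : Fin (n H) → Fin (n G)
    from-to : ∀ v → from (to v) ≡ v
    to-from : ∀ w → to (from w) ≡ w
    adj-pres : ∀ u v → adj H (to u) (to v) ≡ adj G u v

c5adj : Fin 5 → Fin 5 → Bool
c5adj i j = ((suc (toℕ i) % 5) ≡ᵇ toℕ j) ∨ ((suc (toℕ j) % 5) ≡ᵇ toℕ i)

c5loop : ∀ v → c5adj v v ≡ false
c5loop 0F = refl
c5loop 1F = refl
c5loop 2F = refl
c5loop 3F = refl
c5loop 4F = refl

C5 : Graph
C5 = record
  { n = 5
  ; adj = c5adj
  ; sym = λ i j → ∨-comm (((suc (toℕ i) % 5) ≡ᵇ toℕ j)) (((suc (toℕ j) % 5) ≡ᵇ toℕ i))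
  ; loopless = c5loop
  }

-- The subdivided claw S_{a,b,c}.  Vertices 0 .. a+b+c: 0 is the centre,
-- legs are 1..a, a+1..a+b, a+b+1..a+b+c, each traversed as a path
-- starting from a neighbour of the centre.  (Obtained from P_{a+1},
-- P_{b+1}, P_{c+1} by identifying one endvertex of each.)

-- directed edge relation x → y with x < y
sEdge : ℕ → ℕ → ℕ → ℕ → Bool
sEdge a b zero y = (y ≡ᵇ 1) ∨ (y ≡ᵇ suc a) ∨ (y ≡ᵇ suc (a + b))
sEdge a b (suc x) y =
  (y ≡ᵇ suc (suc x)) ∧ not (y ≡ᵇ suc a) ∧ not (y ≡ᵇ suc (a + b))

private
  ≡ᵇ-suc : ∀ m → (m ≡ᵇ suc m) ≡ false
  ≡ᵇ-suc zero = refl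
  ≡ᵇ-suc (suc m) = ≡ᵇ-suc m

  sEdge-irr : ∀ a b x → sEdge a b x x ≡ false
  sEdge-irr a b zero = refl
  sEdge-irr a b (suc x) rewrite ≡ᵇ-suc x = refl

sAdj : (a b c : ℕ) → Fin (suc (a + b + c)) → Fin (suc (a + b + c)) → Bool
sAdj a b c u v = sEdge a b (toℕ u) (toℕ v) ∨ sEdge a b (toℕ v) (toℕ u)

S : ℕ → ℕ → ℕ → Graph
S a b c = record
  { n = suc (a + b + c)
  ; adj = sAdj a b c
  ; sym = λ u v → ∨-comm (sEdge a b (toℕ u) (toℕ v)) (sEdge a b (toℕ v) (toℕ u))
  ; loopless = λ v → helper (toℕ v)
  }
  where
  helper : ∀ x → (sEdge a b x x ∨ sEdge a b x x) ≡ false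
  helper x rewrite sEdge-irr a b x = refl

ExactlyUpToIso : ℕ → (Graph → Set) → Set
ExactlyUpToIso k P = Σ (Fin k → Graph) λ Gs →
  (∀ i → P (Gs i)) ×
  (∀ i j → Iso (Gs i) (Gs j) → i ≡ j) ×
  (∀ G → P G → ∃ λ i → Iso G (Gs i))

{-# OPTIONS --safe #-}

-- A minimal obstruction G is a core: a non-surjective endomorphism of G would, composed with a
-- colouring of G minus a missed vertex, colour G.  Hence if H is an induced subgraph of G and φ a
-- non-surjective endomorphism of H, some vertex w outside H is adjacent to a vertex x of H but not
-- to φ x.  If G has no triangle, the neighbourhood of w in H is independent, so there are few ways
-- to attach w.  Starting from a 5-cycle, a suitable choice of φ at each stage makes this process
-- end, in an induced S_{a,b,c} or in one of the listed obstructions, which then spans G.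
--
-- If G has neither a triangle nor a 5-cycle, its shortest odd closed walk has length at least 7.
-- Three consecutive vertices of degree 2 can always be recoloured, since any two vertices of C5
-- are joined by a walk of length 4; so some vertex of the walk has a third neighbour, and this
-- yields an induced S_{3,1,1} and, with the core property, an induced S_{2,2,1}.

module Submission where

open import Defs
open import Data.Bool using (Bool; true; false; not; _∧_; _∨_)
open import Data.Bool.Properties using (¬-not) renaming (_≟_ to _≟ᵇ_)
open import Data.Empty using (⊥; ⊥-elim)
open import Data.Fin using (Fin; toℕ; opposite; _<_)
open import Data.Fin.Patterns
open import Data.Fin.Properties using (any?; all?; <-cmp; <⇒≢; injective⇒≤; suc-injective) renaming (_≟_ to _≟ᶠ_)
open import Data.List using (List; []; _∷_)
import Data.List as List
open import Data.List.Membership.DecPropositional using (_∈?_)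
open import Data.List.Relation.Unary.Any using (Any; here; there)
import Data.List.Relation.Unary.Any as Any
open import Data.List.Relation.Unary.Any.Properties using (tabulate⁻)
open import Data.Nat using (ℕ; zero; suc; z<s; s<s; _≤?_) renaming (_≟_ to _≟ⁿ_; _<_ to _<ⁿ_)
open import Data.Nat.Induction using (<-rec)
open import Data.Nat.Properties using (≤-refl)
open import Data.Product using (Σ; ∃; _×_; _,_; proj₁; proj₂)
open import Data.Sum using (_⊎_; inj₁; inj₂)
open import Data.Unit using (⊤; tt)
open import Data.Vec using (Vec; []; _∷_; lookup; tabulate)
open import Data.Vec.Properties using (lookup∘tabulate)
import Data.Vec.Functional as F
open import Function using (_∘_; id)
open import Relation.Binary.Definitions using (tri<; tri≈; tri>)
open import Relation.Binary.PropositionalEquality using (_≡_; _≢_; refl; cong; cong₂; subst; trans) renaming (sym to ≡-sym)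
open import Relation.Nullary using (¬_; Dec; yes; no; contradiction; _because_; Reflects; ofʸ; ofⁿ)
open import Relation.Nullary.Decidable using (map′; _×-dec_; _⊎-dec_; _→-dec_; ¬?; from-yes; ¬¬-excluded-middle)
open import Relation.Nullary.Reflects using (_×-reflects_; _⊎-reflects_)

private variable
  k m : ℕ

-- Backtracking search

Solution : (k m : ℕ) → (Fin k → Fin m → Set) → (Fin k → Fin k → Fin m → Fin m → Set) → Set
Solution k m D Q = Σ (Fin k → Fin m) λ f →
  (∀ i → D i (f i)) × (∀ i j → i < j → Q i j (f i) (f j))

-- Boolean code rather than combinators for Dec, because the search is run during type checking.
anyᵇ : ∀ m → (Fin m → Bool) → Bool
anyᵇ zero    p = false
anyᵇ (suc m) p = p 0F ∨ anyᵇ m (p ∘ Fin.suc)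

-- Forward checking: once variable 0 has a value, its binary constraints become tests on the domains
-- of the remaining variables.
search : ∀ k {m} → (Fin k → Fin m → Bool) → (Fin k → Fin k → Fin m → Fin m → Bool) → Bool
search zero        d q = true
search (suc k) {m} d q = anyᵇ m λ x → d 0F x ∧
  search k (λ j y → q 0F (Fin.suc j) x y ∧ d (Fin.suc j) y)
           (λ i j → q (Fin.suc i) (Fin.suc j))

map-reflects : ∀ {A B : Set} {b} → (A → B) → (B → A) → Reflects A b → Reflects B b
map-reflects f g (ofʸ a)  = ofʸ (f a)
map-reflects f g (ofⁿ ¬a) = ofⁿ (¬a ∘ g)

any-reflects : ∀ m {P : Fin m → Set} {p} → (∀ i → Reflects (P i) (p i)) → Reflects (∃ P) (anyᵇ m p)
any-reflects zero    h = ofⁿ λ ()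
any-reflects (suc m) h = map-reflects
  (λ { (inj₁ x) → 0F , x ; (inj₂ (i , x)) → Fin.suc i , x })
  (λ { (0F , x) → inj₁ x ; (Fin.suc i , x) → inj₂ (i , x) })
  (h 0F ⊎-reflects any-reflects m (h ∘ Fin.suc))

search-reflects : ∀ k {m} {D : Fin k → Fin m → Set} {Q : Fin k → Fin k → Fin m → Fin m → Set} {d q} →
  (∀ i x → Reflects (D i x) (d i x)) → (∀ i j x y → Reflects (Q i j x y) (q i j x y)) →
  Reflects (Solution k m D Q) (search k d q)
search-reflects zero D? Q? = ofʸ ((λ ()) , (λ ()) , λ ())
search-reflects (suc k) {m} D? Q? = map-reflects
  (λ (x , d , f , ds , qs) → x F.∷ f
    , (λ { 0F → d ; (Fin.suc j) → proj₂ (ds j) })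
    , λ { 0F (Fin.suc j) _ → proj₁ (ds j) ; (Fin.suc i) (Fin.suc j) (s<s lt) → qs i j lt })
  (λ (f , ds , qs) → f 0F , ds 0F , f ∘ Fin.suc
    , (λ j → qs 0F (Fin.suc j) z<s , ds (Fin.suc j))
    , λ i j lt → qs (Fin.suc i) (Fin.suc j) (s<s lt))
  (any-reflects m λ x → D? 0F x ×-reflects
    search-reflects k (λ j y → Q? 0F (Fin.suc j) x y ×-reflects D? (Fin.suc j) y)
                      (λ i j → Q? (Fin.suc i) (Fin.suc j)))

solve? : ∀ k {m} {D : Fin k → Fin m → Set} {Q : Fin k → Fin k → Fin m → Fin m → Set} →
         (∀ i x → Dec (D i x)) → (∀ i j x y → Dec (Q i j x y)) → Dec (Solution k m D Q)
solve? k D? Q? =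
  search k (λ i x → Dec.does (D? i x)) (λ i j x y → Dec.does (Q? i j x y))
  because search-reflects k (λ i x → Dec.proof (D? i x)) (λ i j x y → Dec.proof (Q? i j x y))

-- Graphs and induced subgraphs

Edge : (G : Graph) → Fin (n G) → Fin (n G) → Set
Edge G u v = adj G u v ≡ true

edge? : ∀ G u v → Dec (Edge G u v)
edge? G u v = adj G u v ≟ᵇ true

¬edge : ∀ G {u v} → ¬ Edge G u v → adj G u v ≡ false
¬edge G = ¬-not

flip : ∀ G {u v} → Edge G u v → Edge G v u
flip G {u} {v} e = trans (sym G v u) e

edge⇒≢ : ∀ G {u v} → Edge G u v → u ≢ v
edge⇒≢ G {u} e refl = contradiction (trans (≡-sym e) (loopless G u)) λ ()

∘-induced : ∀ {G H K} → ContainsInduced G H → ContainsInduced H K → ContainsInduced G K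
∘-induced (f , f-inj , f-pres) (g , g-inj , g-pres) =
  f ∘ g , g-inj ∘ f-inj , λ u v → trans (f-pres (g u) (g v)) (g-pres u v)

symmetrise : ∀ G F (f : Fin (n F) → Fin (n G)) →
  (∀ i j → i < j → adj G (f i) (f j) ≡ adj F i j) → ∀ i j → adj G (f i) (f j) ≡ adj F i j
symmetrise G F f h i j with <-cmp i j
... | tri< lt _ _ = h i j lt
... | tri≈ _ refl _ = trans (loopless G (f i)) (≡-sym (loopless F i))
... | tri> _ _ gt = trans (sym G (f i) (f j)) (trans (h j i gt) (sym F j i))

pairwise⇒induced : ∀ G F (f : Fin (n F) → Fin (n G)) →
  (∀ i j → i < j → f i ≢ f j × adj G (f i) (f j) ≡ adj F i j) → ContainsInduced G F
pairwise⇒induced G F f h = f , inj , symmetrise G F f λ i j lt → proj₂ (h i j lt)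
  where
  inj : ∀ {i j} → f i ≡ f j → i ≡ j
  inj {i} {j} eq with <-cmp i j
  ... | tri< lt _ _ = contradiction eq (proj₁ (h i j lt))
  ... | tri≈ _ i≡j _ = i≡j
  ... | tri> _ _ gt = contradiction (≡-sym eq) (proj₁ (h j i gt))

contains? : ∀ G F → Dec (ContainsInduced G F)
contains? G F = map′
  (λ (_ , f , _ , h) → pairwise⇒induced G F f λ i j lt → proj₁ (h i j lt) , ≡-sym (proj₂ (h i j lt)))
  (λ (f , inj , pres) → injective⇒≤ inj , f , _ , λ i j lt →
    (λ eq → <⇒≢ lt (inj eq)) , ≡-sym (pres i j))
  -- Comparing the orders first spares the search whenever `F` has more vertices than `G`.
  (n F ≤? n G ×-dec
   solve? (n F) (λ _ _ → yes tt)
     (λ i j x y → ¬? (x ≟ᶠ y) ×-dec (adj F i j ≟ᵇ adj G x y)))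

Each : ∀ k → (Fin k → Set) → Set
Each zero    P = ⊤
Each (suc k) P = P 0F × Each k (P ∘ Fin.suc)

-- For a numeral `k` this unfolds to a nested tuple, so a claim about all pairs is proved by listing
-- its instances row by row.
Pairs : ∀ k → (Fin k → Fin k → Set) → Set
Pairs zero    R = ⊤
Pairs (suc k) R = Each k (R 0F ∘ Fin.suc) × Pairs k (λ i j → R (Fin.suc i) (Fin.suc j))

each : ∀ {k P} → Each k P → ∀ i → P i
each (p , _)  0F          = p
each (_ , ps) (Fin.suc i) = each ps i

pairs : ∀ {k R} → Pairs k R → ∀ i j → i < j → R i j
pairs (rs , _) 0F          (Fin.suc j) _       = each rs j
pairs (_ , rs) (Fin.suc i) (Fin.suc j) (s<s p) = pairs rs i j p

Separated : ∀ F → Fin (n F) → Fin (n F) → Set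
Separated F i j = ∃ λ k → adj F i k ≢ adj F j k

separated? : ∀ F i j → Dec (Separated F i j)
separated? F i j = any? λ k → ¬? (adj F i k ≟ᵇ adj F j k)

-- A map preserving adjacency cannot identify vertices with different neighbourhoods, so
-- distinctness of images has to be supplied for twins only.
separated⇒induced : ∀ G F (f : Fin (n F) → Fin (n G)) →
  Pairs (n F) (λ i j → adj G (f i) (f j) ≡ adj F i j) →
  (∀ i j → i ≡ j ⊎ Separated F i j ⊎ f i ≢ f j) → ContainsInduced G F
separated⇒induced G F f h sep = f , inj , pres
  where
  pres : ∀ i j → adj G (f i) (f j) ≡ adj F i j
  pres = symmetrise G F f (pairs h)
  inj : ∀ {i j} → f i ≡ f j → i ≡ j
  inj {i} {j} eq with sep i j
  ... | inj₁ i≡j = i≡j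
  ... | inj₂ (inj₁ (k , ne)) = contradiction
    (trans (≡-sym (pres i k)) (trans (cong (λ v → adj G v (f k)) eq) (pres j k))) ne
  ... | inj₂ (inj₂ ne) = contradiction eq ne

twinFree⇒induced : ∀ G F → (∀ i j → i ≡ j ⊎ Separated F i j) → (f : Fin (n F) → Fin (n G)) →
  Pairs (n F) (λ i j → adj G (f i) (f j) ≡ adj F i j) → ContainsInduced G F
twinFree⇒induced G F sep f h = separated⇒induced G F f h λ i j → weaken (sep i j)
  where
  weaken : ∀ {A B C : Set} → A ⊎ B → A ⊎ B ⊎ C
  weaken (inj₁ a) = inj₁ a
  weaken (inj₂ b) = inj₂ (inj₁ b)

-- Minimal obstructions are cores

others : ∀ {m} → Fin m → Fin m → Bool
others v u = not (Dec.does (u ≟ᶠ v))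

others-≢ : ∀ {m} {v u : Fin m} → u ≢ v → others v u ≡ true
others-≢ {v = v} {u} u≢v with u ≟ᶠ v
... | yes eq = contradiction eq u≢v
... | no _ = refl

others-self : ∀ {m} (v : Fin m) → others v v ≡ false
others-self v with v ≟ᶠ v
... | yes _ = refl
... | no v≢v = contradiction refl v≢v

module _ (G : Graph) (min : MinimalObstruction G C5) where

  colouringWithout : ∀ z → InducedHColorable G (others z) C5
  colouringWithout z = proj₂ min (others z) (z , others-self z)

  no-proper-endomorphism : (Φ : Fin (n G) → Fin (n G)) → (∀ u v → Edge G u v → Edge G (Φ u) (Φ v)) →
    ∀ z → ¬ (∀ u → Φ u ≢ z)
  no-proper-endomorphism Φ hom z missed with colouringWithout z
  ... | c , proper = proj₁ min (c ∘ Φ , λ u v e →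
    proper (Φ u) (Φ v) (others-≢ (missed u)) (others-≢ (missed v)) (hom u v e))

  -- Otherwise φ, extended by the identity, would be an endomorphism of G missing f z.
  escape : ∀ {K} (e : ContainsInduced G K) (φ : Fin (n K) → Fin (n K)) →
    (∀ x y → Edge K x y → Edge K (φ x) (φ y)) → ∀ z → (∀ x → φ x ≢ z) →
    ∃ λ w → (∀ y → w ≢ proj₁ e y) × ∃ λ x → adj G w (proj₁ e x) ≡ true × adj G w (proj₁ e (φ x)) ≡ false
  escape {K} (f , inj , pres) φ hom z missed
    with any? (λ w → all? (λ y → ¬? (w ≟ᶠ f y)) ×-dec
           any? λ x → (adj G w (f x) ≟ᵇ true) ×-dec (adj G w (f (φ x)) ≟ᵇ false))
  ... | yes found = found
  ... | no none = ⊥-elim (no-proper-endomorphism Φ Φ-hom (f z) Φ-missed)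
    where
    data View (u : Fin (n G)) : Set where
      inside  : ∀ x → u ≡ f x → View u
      outside : (∀ x → u ≢ f x) → View u
    view : ∀ u → View u
    view u with any? (λ x → u ≟ᶠ f x)
    ... | yes (x , eq) = inside x eq
    ... | no h = outside λ x eq → h (x , eq)
    image : ∀ {u} → View u → Fin (n G)
    image (inside x _) = f (φ x)
    image {u} (outside _) = u
    Φ : Fin (n G) → Fin (n G)
    Φ u = image (view u)
    Φ-missed : ∀ u → Φ u ≢ f z
    Φ-missed u eq with view u
    ... | inside x _ = missed x (inj eq)
    ... | outside h = h z eq
    stays : ∀ {w} → (∀ y → w ≢ f y) → ∀ x → Edge G w (f x) → Edge G w (f (φ x))
    stays {w} out x e with adj G w (f (φ x)) in eq
    ... | true = refl
    ... | false = ⊥-elim (none (w , out , x , e , eq))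
    Φ-hom : ∀ u v → Edge G u v → Edge G (Φ u) (Φ v)
    Φ-hom u v e with view u | view v
    ... | inside x refl | inside y refl =
      trans (pres (φ x) (φ y)) (hom x y (trans (≡-sym (pres x y)) e))
    ... | inside x refl | outside h = flip G (stays h x (flip G e))
    ... | outside h | inside y refl = stays h y e
    ... | outside _ | outside _ = e

  -- If every neighbour of `u` were a neighbour of `v`, sending `u` to `v` and fixing the rest would
  -- be an endomorphism missing `u`.
  incomparable : ∀ {u v} → u ≢ v → ∃ λ x → Edge G u x × ¬ Edge G v x
  incomparable {u} {v} u≢v
    with any? (λ x → edge? G u x ×-dec ¬? (edge? G v x))
  ... | yes found = found
  ... | no none = ⊥-elim (no-proper-endomorphism Φ Φ-hom u Φ-missed)
    where
    Φ : Fin (n G) → Fin (n G)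
    Φ x with x ≟ᶠ u
    ... | yes _ = v
    ... | no _ = x
    Φ-missed : ∀ x → Φ x ≢ u
    Φ-missed x with x ≟ᶠ u
    ... | yes _ = u≢v ∘ ≡-sym
    ... | no x≢u = x≢u
    transfer : ∀ x → Edge G u x → Edge G v x
    transfer x e with edge? G v x
    ... | yes e′ = e′
    ... | no ne = ⊥-elim (none (x , e , ne))
    Φ-hom : ∀ x y → Edge G x y → Edge G (Φ x) (Φ y)
    Φ-hom x y e with x ≟ᶠ u | y ≟ᶠ u
    ... | yes refl | yes refl = contradiction refl (edge⇒≢ G e)
    ... | yes refl | no _ = transfer y e
    ... | no _ | yes refl = flip G (transfer x (flip G e))
    ... | no _ | no _ = e

-- Recolouring three consecutive vertices of degree two

abstract
  walk₄ : ∀ p q → ∃ λ x → ∃ λ y → ∃ λ z →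
    Edge C5 p x × Edge C5 x y × Edge C5 y z × Edge C5 z q
  walk₄ = from-yes (all? λ p → all? λ q → any? λ x → any? λ y → any? λ z →
    edge? C5 p x ×-dec edge? C5 x y ×-dec edge? C5 y z ×-dec edge? C5 z q)

module _ (G : Graph) (min : MinimalObstruction G C5) where

  -- Otherwise a colouring of `G` without `v` could be changed on `a`, `v`, `b` to a walk of length
  -- 4 in C5 from the colour of `a′` to that of `b′`. These ends may coincide, as `walk₄` covers
  -- closed walks too.
  branching : ∀ {a′ a v b b′} →
    Edge G a′ a → Edge G a v → Edge G v b → Edge G b b′ →
    a ≢ b → a′ ≢ v → a′ ≢ b → b′ ≢ v → b′ ≢ a →
    ∃ λ w → (Edge G a w × w ≢ a′ × w ≢ v) ⊎ (Edge G v w × w ≢ a × w ≢ b) ⊎ (Edge G b w × w ≢ v × w ≢ b′)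
  branching {a′} {a} {v} {b} {b′} a′a av vb bb′ a≢b a′≢v a′≢b b′≢v b′≢a
    with any? (λ w →
           (edge? G a w ×-dec ¬? (w ≟ᶠ a′) ×-dec ¬? (w ≟ᶠ v)) ⊎-dec
           (edge? G v w ×-dec ¬? (w ≟ᶠ a) ×-dec ¬? (w ≟ᶠ b)) ⊎-dec
           (edge? G b w ×-dec ¬? (w ≟ᶠ v) ×-dec ¬? (w ≟ᶠ b′)))
  ... | yes found = found
  ... | no none = ⊥-elim (proj₁ min (recolour , λ u w e → proper u w e (view u) (view w)))
    where
    c : Fin (n G) → Fin 5
    c = proj₁ (colouringWithout G min v)
    x y z : Fin 5
    x = proj₁ (walk₄ (c a′) (c b′))
    y = proj₁ (proj₂ (walk₄ (c a′) (c b′)))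
    z = proj₁ (proj₂ (proj₂ (walk₄ (c a′) (c b′))))
    walk : Edge C5 (c a′) x × Edge C5 x y × Edge C5 y z × Edge C5 z (c b′)
    walk = proj₂ (proj₂ (proj₂ (walk₄ (c a′) (c b′))))
    data View (u : Fin (n G)) : Set where
      is-a : u ≡ a → View u
      is-v : u ≡ v → View u
      is-b : u ≡ b → View u
      rest : u ≢ a → u ≢ v → u ≢ b → View u
    view : ∀ u → View u
    view u with u ≟ᶠ a | u ≟ᶠ v | u ≟ᶠ b
    ... | yes eq | _ | _ = is-a eq
    ... | no _ | yes eq | _ = is-v eq
    ... | no _ | no _ | yes eq = is-b eq
    ... | no ¬a | no ¬v | no ¬b = rest ¬a ¬v ¬b
    colour : ∀ {u} → View u → Fin 5
    colour (is-a _) = x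
    colour (is-v _) = y
    colour (is-b _) = z
    colour {u} (rest _ _ _) = c u
    recolour : Fin (n G) → Fin 5
    recolour u = colour (view u)
    from-a : ∀ {w} → Edge G a w → w ≡ a′ ⊎ w ≡ v
    from-a {w} e with w ≟ᶠ a′ | w ≟ᶠ v
    ... | yes eq | _ = inj₁ eq
    ... | no _ | yes eq = inj₂ eq
    ... | no ¬a′ | no ¬v = ⊥-elim (none (w , inj₁ (e , ¬a′ , ¬v)))
    from-v : ∀ {w} → Edge G v w → w ≡ a ⊎ w ≡ b
    from-v {w} e with w ≟ᶠ a | w ≟ᶠ b
    ... | yes eq | _ = inj₁ eq
    ... | no _ | yes eq = inj₂ eq
    ... | no ¬a | no ¬b = ⊥-elim (none (w , inj₂ (inj₁ (e , ¬a , ¬b))))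
    from-b : ∀ {w} → Edge G b w → w ≡ v ⊎ w ≡ b′
    from-b {w} e with w ≟ᶠ v | w ≟ᶠ b′
    ... | yes eq | _ = inj₁ eq
    ... | no _ | yes eq = inj₂ eq
    ... | no ¬v | no ¬b′ = ⊥-elim (none (w , inj₂ (inj₂ (e , ¬v , ¬b′))))
    proper-a : ∀ {w} → Edge G a w → (k : View w) → Edge C5 x (colour k)
    proper-a e k with from-a e
    proper-a e (is-a refl) | _ = contradiction refl (edge⇒≢ G e)
    proper-a e (is-v _) | _ = proj₁ (proj₂ walk)
    proper-a e (is-b refl) | inj₁ eq = contradiction (≡-sym eq) a′≢b
    proper-a e (is-b refl) | inj₂ eq = contradiction (≡-sym eq) (edge⇒≢ G vb)
    proper-a e (rest _ _ _) | inj₁ refl = flip C5 {c a′} {x} (proj₁ walk)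
    proper-a e (rest _ ¬v _) | inj₂ eq = contradiction eq ¬v
    proper-v : ∀ {w} → Edge G v w → (k : View w) → Edge C5 y (colour k)
    proper-v e (is-a _) = flip C5 {x} {y} (proj₁ (proj₂ walk))
    proper-v e (is-v refl) = contradiction refl (edge⇒≢ G e)
    proper-v e (is-b _) = proj₁ (proj₂ (proj₂ walk))
    proper-v e (rest ¬a _ ¬b) with from-v e
    ... | inj₁ eq = contradiction eq ¬a
    ... | inj₂ eq = contradiction eq ¬b
    proper-b : ∀ {w} → Edge G b w → (k : View w) → Edge C5 z (colour k)
    proper-b e k with from-b e
    proper-b e (is-a refl) | inj₁ eq = contradiction eq (edge⇒≢ G av)
    proper-b e (is-a refl) | inj₂ eq = contradiction (≡-sym eq) b′≢a
    proper-b e (is-v _) | _ = flip C5 {y} {z} (proj₁ (proj₂ (proj₂ walk)))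
    proper-b e (is-b refl) | _ = contradiction refl (edge⇒≢ G e)
    proper-b e (rest _ ¬v _) | inj₁ eq = contradiction eq ¬v
    proper-b e (rest _ _ _) | inj₂ refl = proj₂ (proj₂ (proj₂ walk))
    proper : ∀ u w → Edge G u w → (k : View u) (l : View w) → Edge C5 (colour k) (colour l)
    proper u w e (is-a refl) l = proper-a e l
    proper u w e (is-v refl) l = proper-v e l
    proper u w e (is-b refl) l = proper-b e l
    proper u w e k@(rest _ _ _) (is-a refl) = flip C5 {x} {c u} (proper-a (flip G e) k)
    proper u w e k@(rest _ _ _) (is-v refl) = flip C5 {y} {c u} (proper-v (flip G e) k)
    proper u w e k@(rest _ _ _) (is-b refl) = flip C5 {z} {c u} (proper-b (flip G e) k)
    proper u w e (rest _ ¬v _) (rest _ ¬v′ _) =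
      proj₂ (colouringWithout G min v) u w (others-≢ ¬v) (others-≢ ¬v′) e

-- Graphs built vertex by vertex

infixl 5 _▹_
-- The newest vertex is `0F`; its row records the adjacencies to all older vertices.
data Code : ℕ → Set where
  ∅   : Code 0
  _▹_ : Code m → Vec Bool m → Code (suc m)

codeAdj : Code m → Fin m → Fin m → Bool
codeAdj (H ▹ r) 0F 0F = false
codeAdj (H ▹ r) 0F (Fin.suc j) = lookup r j
codeAdj (H ▹ r) (Fin.suc i) 0F = lookup r i
codeAdj (H ▹ r) (Fin.suc i) (Fin.suc j) = codeAdj H i j

⟦_⟧ : Code m → Graph
⟦ H ⟧ = record { n = _ ; adj = codeAdj H ; sym = symm H ; loopless = irrefl H }
  where
  symm : ∀ {m} (H : Code m) u v → codeAdj H u v ≡ codeAdj H v u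
  symm (H ▹ r) 0F 0F = refl
  symm (H ▹ r) 0F (Fin.suc j) = refl
  symm (H ▹ r) (Fin.suc i) 0F = refl
  symm (H ▹ r) (Fin.suc i) (Fin.suc j) = symm H i j
  irrefl : ∀ {m} (H : Code m) v → codeAdj H v v ≡ false
  irrefl (H ▹ r) 0F = refl
  irrefl (H ▹ r) (Fin.suc i) = irrefl H i

-- Vertices of a code are labelled by order of insertion, so that labels survive extensions.
label : Fin m → ℕ
label v = toℕ (opposite v)

infixl 4 _▹▹_
_▹▹_ : Code m → List ℕ → Code (suc m)
H ▹▹ ns = H ▹ tabulate λ v → Dec.does (_∈?_ _≟ⁿ_ (label v) ns)

c₅ : Code 5
c₅ = ∅ ▹▹ [] ▹▹ 0 ∷ [] ▹▹ 1 ∷ [] ▹▹ 2 ∷ [] ▹▹ 0 ∷ 3 ∷ []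

k₃ : Code 3
k₃ = ∅ ▹▹ [] ▹▹ 0 ∷ [] ▹▹ 0 ∷ 1 ∷ []

abstract
  twinFree-k₃ : ∀ i j → i ≡ j ⊎ Separated ⟦ k₃ ⟧ i j
  twinFree-k₃ = from-yes (all? λ i → all? λ j → i ≟ᶠ j ⊎-dec separated? ⟦ k₃ ⟧ i j)

triangle-free : ∀ G → ¬ ContainsInduced G ⟦ k₃ ⟧ →
  ∀ {a b c} → Edge G a b → Edge G b c → ¬ Edge G c a
triangle-free G no-k₃ {a} {b} {c} ab bc ca =
  no-k₃ (twinFree⇒induced G ⟦ k₃ ⟧ twinFree-k₃ (lookup (a ∷ b ∷ c ∷ []))
    ((ab , flip G ca , tt) , (bc , tt) , tt , tt))

-- Neighbourhoods in a triangle-free graph are independent, so these are the only rows by which a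
-- further vertex can be attached.
Independent : Code m → Vec Bool m → Set
Independent ∅ [] = ⊤
Independent (H ▹ s) (false ∷ r) = Independent H r
Independent (H ▹ s) (true ∷ r) =
  (∀ x → lookup s x ≡ true → lookup r x ≡ false) × Independent H r

-- The oldest vertex is decided first, so a choice that breaks independence is dropped together with
-- all its extensions.
allIndependent? : (H : Code m) {P : Vec Bool m → Set} → (∀ r → Dec (P r)) →
                  Dec (∀ r → Independent H r → P r)
allIndependent? ∅ P? = map′ (λ { p [] tt → p }) (λ h → h [] tt) (P? [])
allIndependent? (H ▹ s) P? = map′
  (λ { h (false ∷ r) i → proj₁ (h r i) ; h (true ∷ r) (d , i) → proj₂ (h r i) d })
  (λ h r i → h (false ∷ r) i , λ d → h (true ∷ r) (d , i))
  (allIndependent? H λ r → P? (false ∷ r) ×-dec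
    (all? (λ x → (lookup s x ≟ᵇ true) →-dec (lookup r x ≟ᵇ false)) →-dec P? (true ∷ r)))

Covers : List Graph → Code m → (Vec Bool m → Set) → Set
Covers Ps H Q = ∀ r → Independent H r → Q r → Any (ContainsInduced ⟦ H ▹ r ⟧) Ps

covers? : ∀ Ps (H : Code m) {Q} → (∀ r → Dec (Q r)) → Dec (Covers Ps H Q)
covers? Ps H Q? = allIndependent? H λ r → Q? r →-dec Any.any? (contains? ⟦ H ▹ r ⟧) Ps

module _ {G : Graph} where

  row : (Fin m → Fin (n G)) → Fin (n G) → Vec Bool m
  row f w = tabulate (adj G w ∘ f)

  extend : {H : Code m} (e : ContainsInduced G ⟦ H ⟧) → ∀ {w} → (∀ y → w ≢ proj₁ e y) →
    ContainsInduced G ⟦ H ▹ row (proj₁ e) w ⟧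
  extend {m} {H} (f , inj , pres) {w} new = g , g-inj , g-pres
    where
    g : Fin (suc m) → Fin (n G)
    g = w F.∷ f
    g-inj : ∀ {i j} → g i ≡ g j → i ≡ j
    g-inj {0F} {0F} eq = refl
    g-inj {0F} {Fin.suc j} eq = contradiction eq (new j)
    g-inj {Fin.suc i} {0F} eq = contradiction (≡-sym eq) (new i)
    g-inj {Fin.suc i} {Fin.suc j} eq = cong Fin.suc (inj eq)
    g-pres : ∀ i j → adj G (g i) (g j) ≡ codeAdj (H ▹ row f w) i j
    g-pres 0F 0F = loopless G w
    g-pres 0F (Fin.suc j) = ≡-sym (lookup∘tabulate (adj G w ∘ f) j)
    g-pres (Fin.suc i) 0F = trans (sym G (f i) w) (≡-sym (lookup∘tabulate (adj G w ∘ f) i))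
    g-pres (Fin.suc i) (Fin.suc j) = pres i j

  module _ (no-k₃ : ¬ ContainsInduced G ⟦ k₃ ⟧) where

    row-independent : (H : Code m) ((f , _) : ContainsInduced G ⟦ H ⟧) → ∀ w → Independent H (row f w)
    row-independent ∅ _ w = tt
    row-independent (H ▹ s) (f , inj , pres) w
      with adj G w (f 0F) in eq
         | row-independent H (f ∘ Fin.suc , (λ e → suc-injective (inj e)) , λ i j → pres (Fin.suc i) (Fin.suc j)) w
    ... | false | ind = ind
    ... | true | ind = (λ x sx → trans (lookup∘tabulate (adj G w ∘ f ∘ Fin.suc) x)
            (¬edge G λ wx → triangle-free G no-k₃ eq (trans (pres 0F (Fin.suc x)) sx) (flip G wx))) , ind

    covers-sound : ∀ {Ps} {H : Code m} {Q} → Covers Ps H Q → (e : ContainsInduced G ⟦ H ⟧) →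
      ∀ w → (∀ y → w ≢ proj₁ e y) → Q (row (proj₁ e) w) → Any (ContainsInduced G) Ps
    covers-sound {H = H} cov e w new q =
      Any.map (λ {P} → ∘-induced {G} {⟦ H ▹ row (proj₁ e) w ⟧} {P} (extend {H = H} e new))
        (cov (row (proj₁ e) w) (row-independent H e w) q)

-- Exhaustive extension from a 5-cycle

record Step : Set where
  constructor step
  field
    {size} : ℕ
    host   : Code size
    moves  : List (ℕ × ℕ)

-- A pair mentioning a label that does not occur is ignored.
fold : List (ℕ × ℕ) → Fin m → Fin m
fold [] v = v
fold ((a , b) ∷ ps) v with label v ≟ⁿ a | any? (λ w → label w ≟ⁿ b)
... | yes _ | yes (w , _) = w
... | _     | _ = fold ps v

Escapes : (Fin m → Fin m) → Vec Bool m → Set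
Escapes φ r = ∃ λ x → lookup r x ≡ true × lookup r (φ x) ≡ false

-- The hypotheses of `escape` for the map `fold ps`, with a check that every row it may yield
-- produces a member of `Ps`.
Justified : List Graph → Step → Set
Justified Ps (step {m} H ps) =
  (∀ x y → codeAdj H x y ≡ true → codeAdj H (fold ps x) (fold ps y) ≡ true) ×
  (∃ λ (z : Fin m) → ∀ x → fold ps x ≢ z) ×
  Covers Ps H (Escapes (fold ps))

justified? : ∀ Ps s → Dec (Justified Ps s)
justified? Ps (step H ps) =
  all? (λ x → all? λ y → (codeAdj H x y ≟ᵇ true) →-dec (codeAdj H (fold ps x) (fold ps y) ≟ᵇ true)) ×-dec
  any? (λ z → all? λ x → ¬? (fold ps x ≟ᶠ z)) ×-dec
  covers? Ps H (λ r → any? λ x → (lookup r x ≟ᵇ true) ×-dec (lookup r (fold ps x) ≟ᵇ false))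

-- A host that has been dealt with counts as forbidden in the steps after it, the last of which is
-- the attachment of a vertex to the 5-cycle itself.
Certified : List Graph → List Step → Set
Certified Ps [] = Covers Ps c₅ λ r → ∃ λ x → lookup r x ≡ true
Certified Ps (s ∷ ss) = Justified Ps s × Certified (⟦ Step.host s ⟧ ∷ Ps) ss

certified? : ∀ Ps ss → Dec (Certified Ps ss)
certified? Ps [] = covers? Ps c₅ λ r → any? λ x → lookup r x ≟ᵇ true
certified? Ps (s ∷ ss) = justified? Ps s ×-dec certified? (⟦ Step.host s ⟧ ∷ Ps) ss

module _ (G : Graph) (min : MinimalObstruction G C5)
         (no-k₃ : ¬ ContainsInduced G ⟦ k₃ ⟧) where

  step-sound : ∀ {Ps} s → Justified Ps s → ContainsInduced G ⟦ Step.host s ⟧ →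
    Any (ContainsInduced G) Ps
  step-sound (step H ps) (hom , (z , missed) , cov) e@(f , _)
    with escape G min {⟦ H ⟧} e (fold ps) hom z missed
  ... | w , new , x , hit , miss = covers-sound {G} no-k₃ {H = H} cov e w new
    (x , trans (lookup∘tabulate (adj G w ∘ f) x) hit
       , trans (lookup∘tabulate (adj G w ∘ f) (fold ps x)) miss)

  -- Every endomorphism of a 5-cycle is bijective, so `escape` cannot start the process; the first
  -- outer vertex comes from `branching` on five consecutive cycle vertices.
  start-sound : ∀ {Ps} → Certified Ps [] → ContainsInduced G ⟦ c₅ ⟧ → Any (ContainsInduced G) Ps
  start-sound cov e@(f , inj , pres)
    with branching G min (pres 0F 1F) (pres 1F 2F) (pres 2F 3F) (pres 3F 4F)
           (differ λ ()) (differ λ ()) (differ λ ()) (differ λ ()) (differ λ ())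
    where
    differ : ∀ {i j} → i ≢ j → f i ≢ f j
    differ ne eq = ne (inj eq)
  ... | w , hit = covers-sound {G} no-k₃ {H = c₅} cov e w (proj₁ (new hit)) (proj₁ (proj₂ (new hit)) ,
          trans (lookup∘tabulate (adj G w ∘ f) _) (proj₂ (proj₂ (new hit))))
    where
    -- The cycle is induced, so a neighbour `w` of `f x` can only coincide with one of the two cycle
    -- neighbours of `f x`.
    fresh : ∀ {x} → Edge G (f x) w → (∀ y → Edge ⟦ c₅ ⟧ x y → w ≢ f y) →
      (∀ y → w ≢ f y) × ∃ λ x → Edge G w (f x)
    fresh {x} e h = (λ y eq → h y (trans (≡-sym (pres x y)) (subst (Edge G (f x)) eq e)) eq) , x , flip G e
    new : (Edge G (f 1F) w × w ≢ f 0F × w ≢ f 2F) ⊎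
          (Edge G (f 2F) w × w ≢ f 1F × w ≢ f 3F) ⊎
          (Edge G (f 3F) w × w ≢ f 2F × w ≢ f 4F) →
          (∀ y → w ≢ f y) × ∃ λ x → Edge G w (f x)
    new (inj₁ (e , p , q)) = fresh e λ { 0F _ → p ; 2F _ → q ; 3F () ; 4F () }
    new (inj₂ (inj₁ (e , p , q))) = fresh e λ { 0F () ; 1F _ → p ; 3F _ → q ; 4F () }
    new (inj₂ (inj₂ (e , p , q))) = fresh e λ { 0F () ; 1F () ; 2F _ → p ; 4F _ → q }

  -- The attachment to the 5-cycle lands in the longest list; hosts are then exchanged, last step
  -- first, for members of the list before, until only `Ps` remains.
  certified-sound : ∀ {Ps} ss → Certified Ps ss → ContainsInduced G ⟦ c₅ ⟧ → Any (ContainsInduced G) Ps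
  certified-sound [] cov e = start-sound cov e
  certified-sound (s ∷ ss) (j , js) e with certified-sound ss js e
  ... | here e′ = step-sound s j e′
  ... | there found = found

-- Odd closed walks

double : ℕ → ℕ
double zero    = zero
double (suc k) = suc (suc (double k))

module _ (G : Graph) where

  infixr 5 _∷_
  data Walk : ℕ → Fin (n G) → Fin (n G) → Set where
    []  : ∀ {u} → Walk 0 u u
    _∷_ : ∀ {l u v w} → Edge G u v → Walk l v w → Walk (suc l) u w

module _ {G : Graph} where

  snoc : ∀ {l u v w} → Walk G l u v → Edge G v w → Walk G (suc l) u w
  snoc []       e = e ∷ []
  snoc (d ∷ ds) e = d ∷ snoc ds e

  reverse : ∀ {l u v} → Walk G l u v → Walk G l v u
  reverse []       = []
  reverse (d ∷ ds) = snoc (reverse ds) (flip G d)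

  uncons : ∀ {l u w} → Walk G (suc l) u w → ∃ λ v → Edge G u v × Walk G l v w
  uncons (d ∷ ds) = _ , d , ds

  even++odd : ∀ k l {u v w} → Walk G (double k) u v → Walk G (suc (double l)) v w →
    ∃ λ m → Walk G (suc (double m)) u w
  even++odd zero    l []           q = l , q
  even++odd (suc k) l (d ∷ d′ ∷ p) q with even++odd k l p q
  ... | m , r = suc m , d ∷ d′ ∷ r

-- Finitely many instances of excluded middle hold jointly up to double negation. This suffices for
-- a contradiction and allows case distinctions on walks of unspecified length.
¬¬-decidable : ∀ m (P : Fin m → Set) → ¬ ¬ (∀ i → Dec (P i))
¬¬-decidable zero    P k = k λ ()
¬¬-decidable (suc m) P k = ¬¬-excluded-middle λ d →
  ¬¬-decidable m (P ∘ Fin.suc) λ ds → k λ { 0F → d ; (Fin.suc i) → ds i }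

-- Colour the component of a vertex r by parity of walks from r; the rest keeps a colouring of G − r.
no-odd-closed-walk : ∀ G → MinimalObstruction G C5 →
  ¬ (∀ k v → ¬ Walk G (suc (double k)) v v)
no-odd-closed-walk G min none with any? {n G} (λ _ → yes tt)
... | no empty = proj₁ min ((λ v → ⊥-elim (empty (v , tt))) , λ v → ⊥-elim (empty (v , tt)))
... | yes (r , _) =
  ¬¬-decidable (n G) Even λ even? → ¬¬-decidable (n G) Odd λ odd? →
    let view : ∀ u → View u
        view u = classify (even? u) (odd? u)
    in proj₁ min ((λ u → colour (view u)) , λ u v e → proper e (view u) (view v))
  where
  Even Odd : Fin (n G) → Set
  Even u = ∃ λ k → Walk G (double k) r u
  Odd u = ∃ λ k → Walk G (suc (double k)) r u
  data View (u : Fin (n G)) : Set where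
    even : Even u → View u
    odd  : ¬ Even u → Odd u → View u
    far  : ¬ Even u → ¬ Odd u → View u
  classify : ∀ {u} → Dec (Even u) → Dec (Odd u) → View u
  classify (yes e) _       = even e
  classify (no ¬e) (yes o) = odd ¬e o
  classify (no ¬e) (no ¬o) = far ¬e ¬o
  colour : ∀ {u} → View u → Fin 5
  colour (even _)      = 0F
  colour (odd _ _)     = 1F
  colour {u} (far _ _) = proj₁ (colouringWithout G min r) u
  even-odd : ∀ {u v} → Edge G u v → Even u → Odd v
  even-odd e (k , p) = k , snoc p e
  odd-even : ∀ {u v} → Edge G u v → Odd u → Even v
  odd-even e (k , p) = suc k , snoc p e
  -- Even walks from `r` to both ends of an edge close up, through that edge, to an odd closed walk
  -- at `r`.
  ¬even-even : ∀ {u v} → Edge G u v → Even u → ¬ Even v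
  ¬even-even e (k , p) (l , q) with even++odd k l p (e ∷ reverse q)
  ... | m , closed = none m r closed
  ≢root : ∀ {u} → ¬ Even u → u ≢ r
  ≢root ¬e refl = ¬e (0 , [])
  proper : ∀ {u v} → Edge G u v → (k : View u) (l : View v) → Edge C5 (colour k) (colour l)
  proper e (even p)   (even q)   = ⊥-elim (¬even-even e p q)
  proper e (even _)   (odd _ _)  = refl
  proper e (even p)   (far _ ¬o) = ⊥-elim (¬o (even-odd e p))
  proper e (odd _ _)  (even _)   = refl
  proper e (odd _ o)  (odd ¬e _) = ⊥-elim (¬e (odd-even e o))
  proper e (odd _ o)  (far ¬e _) = ⊥-elim (¬e (odd-even e o))
  proper e (far _ ¬o) (even q)   = ⊥-elim (¬o (even-odd (flip G e) q))
  proper e (far ¬e _) (odd _ o)  = ⊥-elim (¬e (odd-even (flip G e) o))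
  proper {u} {v} e (far ¬e _) (far ¬e′ _) =
    proj₂ (colouringWithout G min r) u v (others-≢ (≢root ¬e)) (others-≢ (≢root ¬e′)) e

-- Seven consecutive vertices of a closed walk of odd length 7 + 2j.
record Window (G : Graph) (j : ℕ) : Set where
  field
    {u₀ u₁ u₂ u₃ u₄ u₅ u₆} : Fin (n G)
    e₀ : Edge G u₀ u₁
    e₁ : Edge G u₁ u₂
    e₂ : Edge G u₂ u₃
    e₃ : Edge G u₃ u₄
    e₄ : Edge G u₄ u₅
    e₅ : Edge G u₅ u₆
    back : Walk G (suc (double j)) u₆ u₀

module _ {G : Graph} {j : ℕ} where
  open Window

  mirror : Window G j → Window G j
  mirror W = record
    { e₀ = flip G (e₅ W) ; e₁ = flip G (e₄ W) ; e₂ = flip G (e₃ W)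
    ; e₃ = flip G (e₂ W) ; e₄ = flip G (e₁ W) ; e₅ = flip G (e₀ W)
    ; back = reverse (back W) }

  shift : Window G j → Window G j
  shift W = record
    { e₀ = e₁ W ; e₁ = e₂ W ; e₂ = e₃ W ; e₃ = e₄ W ; e₄ = e₅ W
    ; e₅ = proj₁ (proj₂ (uncons (back W))) ; back = snoc (proj₂ (proj₂ (uncons (back W)))) (e₀ W) }

-- Claws along a shortest odd closed walk

abstract
  twinFree-c₅ : ∀ i j → i ≡ j ⊎ Separated ⟦ c₅ ⟧ i j
  twinFree-c₅ = from-yes (all? λ i → all? λ j → i ≟ᶠ j ⊎-dec separated? ⟦ c₅ ⟧ i j)

  twinFree-S221 : ∀ i j → i ≡ j ⊎ Separated (S 2 2 1) i j
  twinFree-S221 = from-yes (all? λ i → all? λ j → i ≟ᶠ j ⊎-dec separated? (S 2 2 1) i j)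

  -- The only twins are the two leaves adjacent to the centre.
  twins-S311 : ∀ i j → i ≡ j ⊎ Separated (S 3 1 1) i j ⊎ (i ≡ 4F × j ≡ 5F) ⊎ (i ≡ 5F × j ≡ 4F)
  twins-S311 = from-yes (all? λ i → all? λ j → i ≟ᶠ j ⊎-dec separated? (S 3 1 1) i j ⊎-dec
    (i ≟ᶠ 4F ×-dec j ≟ᶠ 5F) ⊎-dec (i ≟ᶠ 5F ×-dec j ≟ᶠ 4F))

module _ (G : Graph) (min : MinimalObstruction G C5)
         (no-k₃ : ¬ ContainsInduced G ⟦ k₃ ⟧) where

  no-triangle : ∀ {a b c} → Edge G a b → Edge G b c → adj G a c ≡ false
  no-triangle ab bc = ¬edge G λ ac → triangle-free G no-k₃ ab bc (flip G ac)

  module _ (no-c₅ : ¬ ContainsInduced G ⟦ c₅ ⟧) where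

    -- A chord of a closed walk of length 5 would close a triangle, so the walk is an induced
    -- 5-cycle; its vertices are distinct since C5 has no twins.
    pentagon-free : ∀ {a b c d e} → Edge G a b → Edge G b c → Edge G c d → Edge G d e → ¬ Edge G e a
    pentagon-free {a} {b} {c} {d} {e} ab bc cd de ea =
      no-c₅ (twinFree⇒induced G ⟦ c₅ ⟧ twinFree-c₅ (lookup (a ∷ b ∷ c ∷ d ∷ e ∷ []))
        ( (ab , no-triangle ab bc , no-triangle (flip G ea) (flip G de) , flip G ea , tt)
        , (bc , no-triangle bc cd , no-triangle (flip G ab) (flip G ea) , tt)
        , (cd , no-triangle cd de , tt) , (de , tt) , tt , tt))

    no-pentagon : ∀ {a b c d e} → Edge G a b → Edge G b c → Edge G c d → Edge G d e → adj G a e ≡ false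
    no-pentagon ab bc cd de = ¬edge G λ ae → pentagon-free ab bc cd de (flip G ae)

    Unbranched : ℕ → Set
    Unbranched j = (W : Window G j) → let open Window W in
      ∀ {w} → Edge G u₃ w → w ≢ u₂ → w ≢ u₄ → ⊥

    module _ {j} (short : ∀ v → ¬ Walk G (suc (double (suc (suc j)))) v v) where
      module _ (W : Window G j) where
        open Window W

        -- A walk of length 4 from `u₀` to `u₆` would close up with `back` to length 5 + 2j, which
        -- `short` excludes.
        far-apart : ∀ {a b c} → Edge G u₀ a → Edge G a b → Edge G b c → ¬ Edge G c u₆
        far-apart p q r s = short u₆ (snoc (snoc (snoc (snoc back p) q) r) s)

        no-window-of : Unbranched j → ⊥
        no-window-of unbranched with branching G min e₁ e₂ e₃ e₄
          -- Each coincidence gives a shortcut from `u₀` to `u₆` or a triangle.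
          (λ { refl → far-apart e₀ e₁ e₄ e₅ })
          (λ { refl → far-apart e₀ e₃ e₄ e₅ })
          (λ { refl → triangle-free G no-k₃ e₁ e₂ e₃ })
          (λ { refl → far-apart e₀ e₁ e₂ e₅ })
          (λ { refl → triangle-free G no-k₃ e₂ e₃ e₄ })
        -- The middle vertex of `shift (mirror W)` is `u₂`, that of `shift W` is `u₄`.
        ... | w , inj₁ (e , ≢u₁ , ≢u₃) = unbranched (shift (mirror W)) e ≢u₃ ≢u₁
        ... | w , inj₂ (inj₁ (e , ≢u₂ , ≢u₄)) = unbranched W e ≢u₂ ≢u₄
        ... | w , inj₂ (inj₂ (e , ≢u₃ , ≢u₅)) = unbranched (shift W) e ≢u₃ ≢u₅

        -- Centre `u₃`, long leg `u₄ u₅ u₆`, leaves `u₂` and `w`: of the required non-edges, only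
        -- `w u₅` does not follow from the absence of triangles, 5-cycles and shortcuts.
        claw₃₁₁ : Free (S 3 1 1) G → ∀ {w} → Edge G u₃ w → w ≢ u₂ → Edge G w u₅
        claw₃₁₁ free {w} e w≢u₂ with edge? G w u₅
        ... | yes wu₅ = wu₅
        ... | no ¬wu₅ = ⊥-elim (free (separated⇒induced G (S 3 1 1) f
          ( (e₃ , no-triangle e₃ e₄ , ¬edge G (far-apart e₀ e₁ e₂) , flip G e₂ , e , tt)
          , (e₄ , no-triangle e₄ e₅ , no-triangle (flip G e₃) (flip G e₂) , no-triangle (flip G e₃) e , tt)
          , (e₅ , ¬edge G (λ e₅₂ → far-apart e₀ e₁ (flip G e₅₂) e₅) , ¬edge G (¬wu₅ ∘ flip G) , tt)
          , (no-pentagon (flip G e₅) (flip G e₄) (flip G e₃) (flip G e₂)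
            , no-pentagon (flip G e₅) (flip G e₄) (flip G e₃) e , tt)
          , (no-triangle e₂ e , tt) , tt , tt) sep))
          where
          f : Fin 6 → Fin (n G)
          f = lookup (u₃ ∷ u₄ ∷ u₅ ∷ u₆ ∷ u₂ ∷ w ∷ [])
          sep : ∀ i j → i ≡ j ⊎ Separated (S 3 1 1) i j ⊎ f i ≢ f j
          sep i j with twins-S311 i j
          ... | inj₁ eq = inj₁ eq
          ... | inj₂ (inj₁ s) = inj₂ (inj₁ s)
          ... | inj₂ (inj₂ (inj₁ (refl , refl))) = inj₂ (inj₂ (w≢u₂ ∘ ≡-sym))
          ... | inj₂ (inj₂ (inj₂ (refl , refl))) = inj₂ (inj₂ w≢u₂)

        -- Centre `u₃`, legs `u₄ u₅` and `u₂ u₁`, leaf `w`: only the pairs `w u₁` and `w u₅` are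
        -- left open.
        claw₂₂₁ : Free (S 2 2 1) G → ∀ {w} → Edge G u₃ w → ¬ Edge G w u₁ → Edge G w u₅
        claw₂₂₁ free {w} e ¬wu₁ with edge? G w u₅
        ... | yes wu₅ = wu₅
        ... | no ¬wu₅ = ⊥-elim (free (twinFree⇒induced G (S 2 2 1) twinFree-S221
          (lookup (u₃ ∷ u₄ ∷ u₅ ∷ u₂ ∷ u₁ ∷ w ∷ []))
          ( (e₃ , no-triangle e₃ e₄ , flip G e₂ , no-triangle (flip G e₂) (flip G e₁) , e , tt)
          , (e₄ , no-triangle (flip G e₃) (flip G e₂)
            , ¬edge G (λ e₄₁ → far-apart e₀ (flip G e₄₁) e₄ e₅) , no-triangle (flip G e₃) e , tt)
          , (¬edge G (λ e₅₂ → far-apart e₀ e₁ (flip G e₅₂) e₅)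
            , no-pentagon (flip G e₄) (flip G e₃) (flip G e₂) (flip G e₁) , ¬edge G (¬wu₅ ∘ flip G) , tt)
          , (flip G e₁ , no-triangle e₂ e , tt) , (¬edge G (¬wu₁ ∘ flip G) , tt) , tt , tt)))

        -- The claw is centred at `u₄`, with legs `w x` and `u₅ u₆` and leaf `u₃`.
        twin-claw₂₂₁ : Free (S 2 2 1) G → ∀ {w x} → Edge G u₂ w → Edge G w u₄ →
          Edge G w x → ¬ Edge G u₃ x → Edge G x u₅
        twin-claw₂₂₁ free {w} {x} u₂w wu₄ wx ¬u₃x with edge? G x u₅
        ... | yes xu₅ = xu₅
        ... | no ¬xu₅ = ⊥-elim (free (twinFree⇒induced G (S 2 2 1) twinFree-S221
          (lookup (u₄ ∷ w ∷ x ∷ u₅ ∷ u₆ ∷ u₃ ∷ []))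
          ( (flip G wu₄ , no-triangle (flip G wu₄) wx , e₄ , no-triangle e₄ e₅ , flip G e₃ , tt)
          , (wx , no-triangle wu₄ e₄ , ¬edge G (far-apart e₀ e₁ u₂w) , no-triangle wu₄ (flip G e₃) , tt)
          , (¬edge G ¬xu₅ , no-pentagon (flip G wx) wu₄ e₄ e₅ , ¬edge G (¬u₃x ∘ flip G) , tt)
          , (e₅ , no-triangle (flip G e₄) (flip G e₃) , tt)
          , (¬edge G (far-apart e₀ e₁ e₂ ∘ flip G) , tt) , tt , tt)))

      -- Read in both directions, the claw makes `w` adjacent to `u₁` and `u₅`, and `u₀ u₁ w u₅ u₆`
      -- is a shortcut.
      unbranched₃₁₁ : Free (S 3 1 1) G → Unbranched j
      unbranched₃₁₁ free W e ≢u₂ ≢u₄ = far-apart W e₀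
        (flip G (claw₃₁₁ (mirror W) free e ≢u₄)) (claw₃₁₁ W free e ≢u₂) e₅
        where open Window W

      -- As `G` is a core, `w` has a neighbour `x` not adjacent to `u₃`; the claws at `u₂` and `u₄`
      -- make `u₀ u₁ x u₅ u₆` a shortcut.
      no-twin : Free (S 2 2 1) G → (W : Window G j) → let open Window W in
        ∀ {w} → w ≢ u₃ → Edge G u₂ w → Edge G w u₄ → ⊥
      no-twin free W {w} w≢u₃ u₂w wu₄ with incomparable G min w≢u₃
      ... | x , wx , ¬u₃x = far-apart W e₀
        (flip G (twin-claw₂₂₁ (mirror W) free (flip G wu₄) (flip G u₂w) wx ¬u₃x))
        (twin-claw₂₂₁ W free u₂w wu₄ wx ¬u₃x) e₅
        where open Window W

      -- By the claw at `u₃`, `w` is adjacent to `u₁` or `u₅`, so together with `u₃` it shares two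
      -- neighbours with `u₂` or is such a rival of `u₄`; a shifted window reduces this to
      -- `no-twin`.
      unbranched₂₂₁ : Free (S 2 2 1) G → Unbranched j
      unbranched₂₂₁ free W {w} e ≢u₂ ≢u₄ with edge? G w (Window.u₁ W)
      ... | yes wu₁ = no-twin free (shift (mirror W)) ≢u₂ e wu₁
      ... | no ¬wu₁ = no-twin free (shift W) ≢u₄ e (claw₂₂₁ W free e ¬wu₁)

    -- Strong induction on `k` for closed walks of length 2k + 1: lengths 1, 3 and 5 are excluded
    -- outright, and a longer walk supplies a window while the preceding odd length is already
    -- excluded.
    no-long-odd-cycle : (∀ j → (∀ v → ¬ Walk G (suc (double (suc (suc j)))) v v) → Unbranched j) → ⊥
    no-long-odd-cycle unbranched = no-odd-closed-walk G min (<-rec _ λ k shorter → excluded k shorter)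
      where
      excluded : ∀ k → (∀ {i} → i <ⁿ k → ∀ v → ¬ Walk G (suc (double i)) v v) →
        ∀ v → ¬ Walk G (suc (double k)) v v
      excluded 0 _ v (e ∷ []) = edge⇒≢ G e refl
      excluded 1 _ v (a ∷ b ∷ c ∷ []) = triangle-free G no-k₃ a b c
      excluded 2 _ v (a ∷ b ∷ c ∷ d ∷ e ∷ []) = pentagon-free a b c d e
      excluded (suc (suc (suc j))) shorter v (a ∷ b ∷ c ∷ d ∷ e ∷ f ∷ p) =
        no-window-of (shorter ≤-refl)
          (record { e₀ = a ; e₁ = b ; e₂ = c ; e₃ = d ; e₄ = e ; e₅ = f ; back = p })
          (unbranched j (shorter ≤-refl))

-- Obstructions

colourable? : ∀ G keep → Dec (InducedHColorable G keep C5)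
colourable? G keep = map′
  (λ (c , _ , h) → c , λ u v → proper c h u v)
  (λ (c , h) → c , _ , λ i j _ → h i j)
  (solve? (n G) (λ _ _ → yes tt) λ i j x y →
    (keep i ≟ᵇ true) →-dec (keep j ≟ᵇ true) →-dec edge? G i j →-dec edge? C5 x y)
  where
  proper : ∀ c → (∀ i j → i < j → keep i ≡ true → keep j ≡ true → Edge G i j → Edge C5 (c i) (c j)) →
    ∀ u v → keep u ≡ true → keep v ≡ true → Edge G u v → Edge C5 (c u) (c v)
  proper c h u v ku kv e with <-cmp u v
  ... | tri< lt _ _ = h u v lt ku kv e
  ... | tri≈ _ refl _ = contradiction refl (edge⇒≢ G e)
  ... | tri> _ _ gt = flip C5 {c v} {c u} (h v u gt kv ku (flip G e))

-- A decidable form of minimality: deleting single vertices suffices, because colourings restrict to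
-- smaller vertex sets.
Critical : Graph → Set
Critical G = ¬ InducedHColorable G (λ _ → true) C5 × ∀ v → InducedHColorable G (others v) C5

critical? : ∀ G → Dec (Critical G)
critical? G = ¬? (colourable? G λ _ → true) ×-dec all? λ v → colourable? G (others v)

critical⇒minimal : ∀ G → Critical G → MinimalObstruction G C5
critical⇒minimal G (¬col , cols) =
  (λ (c , h) → ¬col (c , λ u v _ _ → h u v)) , restrict
  where
  restrict : ∀ T → (∃ λ v → T v ≡ false) → InducedHColorable G T C5
  restrict T (v , out) with cols v
  ... | c , h = c , λ u w Tu Tw → h u w (others-≢ (inside Tu)) (others-≢ (inside Tw))
    where
    inside : ∀ {u} → T u ≡ true → u ≢ v
    inside Tu refl = contradiction (trans (≡-sym Tu) out) λ ()

-- If the copy of `K` missed a vertex `v`, a colouring of `G` without `v` would colour `K`.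
obstruction-spans : ∀ {G K} → MinimalObstruction G C5 → ¬ HColorable K C5 →
  ContainsInduced G K → Iso G K
obstruction-spans {G} {K} min ¬col (f , inj , pres) = record
  { to = λ v → proj₁ (preimage v)
  ; from = f
  ; from-to = λ v → proj₂ (preimage v)
  ; to-from = λ w → inj (proj₂ (preimage (f w)))
  ; adj-pres = λ u v → trans (≡-sym (pres _ _)) (cong₂ (adj G) (proj₂ (preimage u)) (proj₂ (preimage v)))
  }
  where
  preimage : ∀ v → ∃ λ x → f x ≡ v
  preimage v with any? (λ x → f x ≟ᶠ v)
  ... | yes found = found
  ... | no none with colouringWithout G min v
  ...   | c , h = ⊥-elim (¬col (c ∘ f , λ x y e →
    h (f x) (f y) (others-≢ λ eq → none (x , eq)) (others-≢ λ eq → none (y , eq))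
      (trans (pres x y) e)))

iso⇒contains : ∀ {G H} → Iso G H → ContainsInduced H G
iso⇒contains i = to , (λ {u} {v} eq → trans (≡-sym (from-to u)) (trans (cong from eq) (from-to v))) , adj-pres
  where open Iso i

-- A triangle yields a listed graph, absence of 5-cycles is refuted by odd walks, and an induced
-- 5-cycle leads through the certificate to `F` or a listed graph. A listed graph, once found,
-- spans.
classification : ∀ F (Gs : Fin k → Graph) ss →
  (∀ i → Critical (Gs i) × ¬ ContainsInduced (Gs i) F) →
  (∀ i j → i ≡ j ⊎ ¬ ContainsInduced (Gs j) (Gs i)) →
  (∃ λ i → ContainsInduced ⟦ k₃ ⟧ (Gs i)) →
  Certified (F ∷ List.tabulate Gs) ss →
  (∀ G (min : MinimalObstruction G C5) (no-k₃ : ¬ ContainsInduced G ⟦ k₃ ⟧) (no-c₅ : ¬ ContainsInduced G ⟦ c₅ ⟧) →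
    Free F G → ∀ {j} → (∀ v → ¬ Walk G (suc (double (suc (suc j)))) v v) → Unbranched G min no-k₃ no-c₅ j) →
  ExactlyUpToIso k (λ G → Free F G × MinimalObstruction G C5)
classification F Gs ss obstructions incomparables (t , triangle) cert unbranched =
  Gs , (λ i → proj₂ (obstructions i) , critical⇒minimal (Gs i) (proj₁ (obstructions i))) , distinct , complete
  where
  distinct : ∀ i j → Iso (Gs i) (Gs j) → i ≡ j
  distinct i j iso with incomparables i j
  ... | inj₁ eq = eq
  ... | inj₂ ¬c = ⊥-elim (¬c (iso⇒contains {Gs i} {Gs j} iso))
  spans : ∀ {G} → MinimalObstruction G C5 → ∀ i → ContainsInduced G (Gs i) → ∃ λ i → Iso G (Gs i)
  spans min i e = i , obstruction-spans min (proj₁ (critical⇒minimal (Gs i) (proj₁ (obstructions i)))) e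
  complete : ∀ G → Free F G × MinimalObstruction G C5 → ∃ λ i → Iso G (Gs i)
  complete G (free , min) with contains? G ⟦ k₃ ⟧
  ... | yes e = spans min t (∘-induced {G} {⟦ k₃ ⟧} {Gs t} e triangle)
  ... | no no-k₃ with contains? G ⟦ c₅ ⟧
  ...   | no no-c₅ = ⊥-elim (no-long-odd-cycle G min no-k₃ no-c₅ λ j → unbranched G min no-k₃ no-c₅ free)
  ...   | yes e with certified-sound G min no-k₃ ss cert e
  ...     | here bad = ⊥-elim (free bad)
  ...     | there found with tabulate⁻ found
  ...       | i , e′ = spans min i e′

-- In both cases the hosts are the graphs met by the extension process, descendants first, and
-- each fold is one leaving fewest attachments up to isomorphism; both come from a computer search.
module S₂₂₁ where

  h₆ h₆′ : Code 6
  h₆  = c₅ ▹▹ 0 ∷ 2 ∷ []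
  h₆′ = c₅ ▹▹ 0 ∷ []

  h₇ h₇′ : Code 7
  h₇  = h₆′ ▹▹ 2 ∷ 4 ∷ 5 ∷ []
  h₇′ = h₆′ ▹▹ 4 ∷ 5 ∷ []

  h₈ h₈′ : Code 8
  h₈  = h₇′ ▹▹ 1 ∷ 3 ∷ 5 ∷ []
  h₈′ = h₇′ ▹▹ 1 ∷ 5 ∷ []

  h₉ h₉′ : Code 9
  h₉  = h₈′ ▹▹ 1 ∷ 3 ∷ 6 ∷ []
  h₉′ = h₈′ ▹▹ 3 ∷ 6 ∷ []

  h₁₀ h₁₀′ : Code 10
  h₁₀  = h₉′ ▹▹ 2 ∷ 4 ∷ 7 ∷ 8 ∷ []
  h₁₀′ = h₉′ ▹▹ 2 ∷ 7 ∷ 8 ∷ []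

  h₁₁ h₁₁′ : Code 11
  h₁₁  = h₁₀′ ▹▹ 2 ∷ 4 ∷ 5 ∷ 8 ∷ []
  h₁₁′ = h₁₀′ ▹▹ 4 ∷ 5 ∷ 8 ∷ []

  h₁₂ : Code 12
  h₁₂ = h₁₁′ ▹▹ 1 ∷ 3 ∷ 9 ∷ 10 ∷ []

  -- The Wagner graph: the 8-cycle 0 5 7 6 1 2 3 4 with its four long diagonals.
  o₈ : Code 8
  o₈ = c₅ ▹▹ 0 ∷ 2 ∷ [] ▹▹ 1 ∷ 4 ∷ [] ▹▹ 3 ∷ 5 ∷ 6 ∷ []

  -- The circulant graph on the integers modulo 13 with differences ±1 and ±3, the residues 0 to 12
  -- being the labels 1 6 5 2 11 10 3 12 9 4 8 7 0.
  o₁₃ : Code 13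
  o₁₃ = c₅ ▹▹ 0 ∷ 2 ∷ [] ▹▹ 1 ∷ 5 ∷ [] ▹▹ 0 ∷ 6 ∷ [] ▹▹ 1 ∷ 4 ∷ 7 ∷ []
    ▹▹ 4 ∷ 7 ∷ [] ▹▹ 3 ∷ 5 ∷ 9 ∷ [] ▹▹ 2 ∷ 6 ∷ 10 ∷ [] ▹▹ 3 ∷ 8 ∷ 9 ∷ 11 ∷ []

  obstruction : Fin 3 → Graph
  obstruction = lookup (⟦ k₃ ⟧ ∷ ⟦ o₈ ⟧ ∷ ⟦ o₁₃ ⟧ ∷ [])

  steps : List Step
  steps =
      step h₁₂ ((6 , 10) ∷ [])
    ∷ step h₁₁′ ((10 , 6) ∷ [])
    ∷ step h₁₁ ((6 , 10) ∷ [])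
    ∷ step h₁₀′ ((5 , 1) ∷ (6 , 0) ∷ (7 , 2) ∷ (8 , 4) ∷ (9 , 3) ∷ [])
    ∷ step h₁₀ ((8 , 4) ∷ [])
    ∷ step h₉′ ((7 , 0) ∷ [])
    ∷ step h₉ ((7 , 0) ∷ [])
    ∷ step h₈′ ((6 , 0) ∷ [])
    ∷ step h₈ ((6 , 0) ∷ [])
    ∷ step h₇′ ((5 , 4) ∷ [])
    ∷ step h₇ ((5 , 4) ∷ [])
    ∷ step h₆′ ((5 , 1) ∷ [])
    ∷ step h₆ ((5 , 1) ∷ [])
    ∷ []

  abstract
    critical : ∀ i → Critical (obstruction i) × ¬ ContainsInduced (obstruction i) (S 2 2 1)
    critical = from-yes (all? λ i → critical? (obstruction i) ×-dec ¬? (contains? (obstruction i) (S 2 2 1)))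

    antichain : ∀ i j → i ≡ j ⊎ ¬ ContainsInduced (obstruction j) (obstruction i)
    antichain = from-yes (all? λ i → all? λ j → i ≟ᶠ j ⊎-dec ¬? (contains? (obstruction j) (obstruction i)))

    certified : Certified (S 2 2 1 ∷ List.tabulate obstruction) steps
    certified = from-yes (certified? (S 2 2 1 ∷ List.tabulate obstruction) steps)

module S₃₁₁ where

  h₆ h₆′ : Code 6
  h₆  = c₅ ▹▹ 0 ∷ 2 ∷ []
  h₆′ = c₅ ▹▹ 0 ∷ []

  h₇ h₇′ h₇″ h₇‴ h₇⁗ : Code 7
  h₇  = h₆ ▹▹ 5 ∷ []
  h₇′ = h₆′ ▹▹ 2 ∷ 4 ∷ 5 ∷ []
  h₇″ = h₆′ ▹▹ 3 ∷ 5 ∷ []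
  h₇‴ = h₆′ ▹▹ 4 ∷ 5 ∷ []
  h₇⁗ = h₆′ ▹▹ 5 ∷ []

  h₈ h₈′ h₈″ : Code 8
  h₈  = h₇ ▹▹ 2 ∷ 4 ∷ 6 ∷ []
  h₈′ = h₇′ ▹▹ 2 ∷ 5 ∷ []
  h₈″ = h₇⁗ ▹▹ 4 ∷ 6 ∷ []

  -- `o₈` and `o₈′` are subdivisions of K₄ whose four triangles become 5-cycles, `o₈″` is K₃,₃ with
  -- two disjoint edges subdivided once, and `o₈‴` is the Wagner graph.
  o₈ o₈′ o₈″ o₈‴ : Code 8
  o₈  = c₅ ▹▹ 2 ∷ 4 ∷ [] ▹▹ 3 ∷ [] ▹▹ 5 ∷ 6 ∷ []
  o₈′ = c₅ ▹▹ 4 ∷ [] ▹▹ 1 ∷ 5 ∷ [] ▹▹ 3 ∷ 6 ∷ []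
  o₈″ = c₅ ▹▹ 1 ∷ 3 ∷ [] ▹▹ 4 ∷ 5 ∷ [] ▹▹ 2 ∷ 6 ∷ []
  o₈‴ = c₅ ▹▹ 0 ∷ 2 ∷ [] ▹▹ 1 ∷ 4 ∷ [] ▹▹ 3 ∷ 5 ∷ 6 ∷ []

  obstruction : Fin 5 → Graph
  obstruction = lookup (⟦ k₃ ⟧ ∷ ⟦ o₈ ⟧ ∷ ⟦ o₈′ ⟧ ∷ ⟦ o₈″ ⟧ ∷ ⟦ o₈‴ ⟧ ∷ [])

  steps : List Step
  steps =
      step h₈″ ((5 , 1) ∷ (6 , 2) ∷ (7 , 3) ∷ [])
    ∷ step h₇⁗ ((5 , 1) ∷ (6 , 0) ∷ [])
    ∷ step h₇‴ ((5 , 1) ∷ (6 , 0) ∷ [])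
    ∷ step h₇″ ((5 , 1) ∷ (6 , 2) ∷ [])
    ∷ step h₈′ ((5 , 4) ∷ (7 , 3) ∷ [])
    ∷ step h₇′ ((5 , 4) ∷ [])
    ∷ step h₆′ ((5 , 1) ∷ [])
    ∷ step h₈ ((6 , 2) ∷ [])
    ∷ step h₇ ((6 , 0) ∷ [])
    ∷ step h₆ ((5 , 1) ∷ [])
    ∷ []

  abstract
    critical : ∀ i → Critical (obstruction i) × ¬ ContainsInduced (obstruction i) (S 3 1 1)
    critical = from-yes (all? λ i → critical? (obstruction i) ×-dec ¬? (contains? (obstruction i) (S 3 1 1)))

    antichain : ∀ i j → i ≡ j ⊎ ¬ ContainsInduced (obstruction j) (obstruction i)
    antichain = from-yes (all? λ i → all? λ j → i ≟ᶠ j ⊎-dec ¬? (contains? (obstruction j) (obstruction i)))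

    certified : Certified (S 3 1 1 ∷ List.tabulate obstruction) steps
    certified = from-yes (certified? (S 3 1 1 ∷ List.tabulate obstruction) steps)

theorem2 : ExactlyUpToIso 3 (λ G → Free (S 2 2 1) G × MinimalObstruction G C5)
    × ExactlyUpToIso 5 (λ G → Free (S 3 1 1) G × MinimalObstruction G C5)
theorem2 =
  classification (S 2 2 1) S₂₂₁.obstruction S₂₂₁.steps S₂₂₁.critical S₂₂₁.antichain
    (0F , id , id , λ _ _ → refl) S₂₂₁.certified
    (λ G min no-k₃ no-c₅ free short → unbranched₂₂₁ G min no-k₃ no-c₅ short free) ,
  classification (S 3 1 1) S₃₁₁.obstruction S₃₁₁.steps S₃₁₁.critical S₃₁₁.antichain
    (0F , id , id , λ _ _ → refl) S₃₁₁.certified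
    (λ G min no-k₃ no-c₅ free short → unbranched₃₁₁ G min no-k₃ no-c₅ short free)
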